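{- For any integer $n\geqslant 0$, $$\sum_{j=0}^{\infty}(-1)^{j(j+1)/2}\,\sigma\,\mathrm{mex}\big(n-j(j+1)/2\big)=\sum_{j=0}^{\infty}D_1\!\left(\frac{n-j(j+1)/2}{2}\right).$$
   Context: For a partition $\lambda$, $\mathrm{mex}(\lambda)$ is the smallest positive integer that is not a part of $\lambda$ (the empty partition has mex $1$). For an integer $m\geqslant 0$, $\sigma\,\mathrm{mex}(m)$ is the sum of $\mathrm{mex}(\lambda)$ over all partitions $\lambda$ of $m$; $\sigma\,\mathrm{mex}(m)=0$ for $m<0$. For a non-negative integer $m$, $D_1(m)$ is the number of partitions of $m$ into distinct parts (so $D_1(0)=1$); $D_1(x)=0$ if $x$ is not a non-negative integer. -}

module Defs where

open import Data.Nat using (ℕ; zero; suc; _+_; _*_; _∸_; _≤?_; _/_; _%_)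
open import Data.Nat.Properties using (_≟_)
open import Data.Integer using (ℤ; +_; -_)
import Data.Integer as ℤ
open import Data.List using (List; []; _∷_; [_]; _++_; map; concatMap; replicate; upTo; length; filter; foldr)
open import Data.Nat.ListAction using (sum)
open import Data.List.Membership.DecPropositional _≟_ using (_∈?_)

open import Data.List.Relation.Unary.Unique.DecPropositional _≟_ using (unique?)
open import Relation.Nullary using (yes; no)

-- A partition is represented as a non-increasing list of positive parts.
-- partsUpTo k m : all partitions of m whose parts lie in {1,…,k},
-- each listed exactly once (choose the multiplicity c of the part k,
-- then recurse on the smaller parts).
partsUpTo : ℕ → ℕ → List (List ℕ)
partsUpTo zero zero = [ [] ]
partsUpTo zero (suc m) = []
partsUpTo (suc k) m =
  concatMap (λ c → map (replicate c (suc k) ++_) (partsUpTo k (m ∸ c * suc k)))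
            (filter (λ c → c * suc k ≤? m) (upTo (suc m)))

partitions : ℕ → List (List ℕ)
partitions m = partsUpTo m m

-- mex λ : smallest positive integer not a part of λ.
-- searching from k, with fuel; fuel length λ + 1 always suffices.
mexSearch : ℕ → ℕ → List ℕ → ℕ
mexSearch zero k λ′ = k
mexSearch (suc f) k λ′ with k ∈? λ′
... | yes _ = mexSearch f (suc k) λ′
... | no _  = k

mex : List ℕ → ℕ
mex λ′ = mexSearch (suc (length λ′)) 1 λ′

σmex : ℕ → ℕ
σmex m = sum (map mex (partitions m))

D₁ : ℕ → ℕ
D₁ m = length (filter unique? (partitions m))

tri : ℕ → ℕ
tri j = (j * suc j) / 2

signPow : ℕ → ℤ
signPow e with e % 2
... | zero = + 1
... | suc _ = - (+ 1)

σmexShift : ℕ → ℕ → ℕ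
σmexShift n x with x ≤? n
... | yes _ = σmex (n ∸ x)
... | no _  = 0

D₁half : ℕ → ℕ → ℕ
D₁half n x with x ≤? n
... | no _ = 0
... | yes _ with (n ∸ x) % 2
...   | zero  = D₁ ((n ∸ x) / 2)
...   | suc _ = 0

sumℤ : List ℤ → ℤ
sumℤ = foldr ℤ._+_ (+ 0)

-- The infinite sums are finite: for j > n we have j(j+1)/2 ≥ j > n, so
-- every term with j > n vanishes.  We sum over j = 0,…,n.
lhs : ℕ → ℤ
lhs n = sumℤ (map (λ j → signPow (tri j) ℤ.* (+ σmexShift n (tri j))) (upTo (suc n)))

rhs : ℕ → ℕ
rhs n = sum (map (λ j → D₁half n (tri j)) (upTo (suc n)))

{-# OPTIONS --safe #-}

-- Write ψ(q) = Σ_j q^(j(j+1)/2) and P(q) for the generating function of the partitions.  Since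
-- mex μ counts the j ≥ 0 such that 1, …, j are all parts of μ, the generating function of σmex is
-- ψ(q) P(q).  Hence it suffices that ψ(-q) P(q) = ∏_{i≥1} (1 + q^(2i)).  This follows from a finite
-- form of Gauss's product for ψ in the style of Shanks: ∏_{i<n} (1 + q^(2i+1)) · Σ_{j≤2n} (-q)^(j(j+1)/2)
-- equals an explicit sum of n + 1 products, the first of which is ∏_{1≤i≤n} (1 - q^(2i)) while the
-- others are divisible by q^(2n+1).
-- Instead of power series we use values of truncated series at integers q, modulo q^N: sequences
-- whose truncations are congruent for every q > 0 agree in their first N terms.
module Submission where

open import Defs
open import Data.Nat as ℕ using (ℕ; zero; suc; z≤n; s≤s)
import Data.Nat.Properties as ℕ
open import Data.Nat.Divisibility using (divides-refl)
open import Data.Nat.DivMod using (m*n/n≡m; +-distrib-/-∣ˡ; m≡m%n+[m/n]*n; m%n<n; m/n≤m)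
open import Data.Nat.ListAction using (sum)
import Data.Nat.Tactic.RingSolver as ℕ-Solver
open import Data.Fin using (Fin; toℕ; fromℕ<)
import Data.Fin.Properties as Fin
open import Data.Integer using (ℤ; +_; -_; _+_; _*_; _-_; _^_; 0ℤ; 1ℤ; ∣_∣)
open import Data.Integer.Properties
open import Data.Integer.Tactic.RingSolver using (solve-∀)
open import Algebra.Properties.AbelianGroup +-0-abelianGroup using (∙-cancelˡ)
open import Data.List using (List; []; _∷_; _++_; map; concatMap; replicate; upTo; applyUpTo; length; filter; lookup)
open import Data.List.Properties using (map-upTo; map-∘; map-++)
open import Data.List.Membership.Propositional using (_∈_)
open import Data.List.Membership.DecPropositional ℕ._≟_ using (_∈?_)
open import Data.List.Membership.Propositional.Properties using (∈-++⁺ʳ; ∈-++⁻)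
open import Data.List.Relation.Unary.All as All using (All; []; _∷_)
import Data.List.Relation.Unary.All.Properties as All
open import Data.List.Relation.Unary.AllPairs using (_∷_)
open import Data.List.Relation.Unary.Any using (index; here)
open import Data.List.Relation.Unary.Any.Properties using (lookup-index)
open import Data.List.Relation.Unary.Unique.DecPropositional ℕ._≟_ using (unique?)
open import Data.Sum using (_⊎_; inj₁; inj₂)
open import Function using (_∘_)
open import Relation.Binary.Bundles using (Setoid)
open import Relation.Binary.PropositionalEquality hiding (J)
import Relation.Binary.Reasoning.Setoid
open import Relation.Nullary using (Dec; yes; no; ¬_; contradiction)

-- Finite form of Gauss's product for the triangular numbers.

-- The q-Pochhammer symbol (x; q²)_d.
poch : ℤ → ℤ → ℕ → ℤ
poch q x zero    = 1ℤ
poch q x (suc d) = (1ℤ - x) * poch q (x * (q * q)) d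

poch-last : ∀ q x d → poch q x (suc d) ≡ poch q x d * (1ℤ - x * (q * q) ^ d)
poch-last q x zero = lem x
  where
  lem : ∀ x → (1ℤ - x) * 1ℤ ≡ 1ℤ * (1ℤ - x * 1ℤ)
  lem = solve-∀
poch-last q x (suc d) = trans (cong ((1ℤ - x) *_) (poch-last q (x * (q * q)) d)) (lem x (q * q) _ _)
  where
  lem : ∀ x r p s → (1ℤ - x) * (p * (1ℤ - x * r * s)) ≡ (1ℤ - x) * p * (1ℤ - x * (r * s))
  lem = solve-∀

-- Σ_{s≤d} (-a)^s · ∏_{i<s} (1 + u q^(2i+1)) · ∏_{s<i≤d} (1 - u q^(2i)), nested in the manner of Horner.
horner : ℤ → ℕ → ℤ → ℤ → ℤ
horner q zero    u a = 1ℤ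
horner q (suc d) u a =
  poch q (u * (q * q)) (suc d) - a * (1ℤ + u * q) * horner q d (u * (q * q)) a

-- Lets an equation `x ≡ y` enter a ring identity: the solver proves the identity up to
-- `k * (x - y)`, and this lemma removes that summand.
drop-zero : ∀ z k {x y} → x ≡ y → z + k * (x - y) ≡ z
drop-zero z k {x} refl = lem z k x
  where
  lem : ∀ z k x → z + k * (x - x) ≡ z
  lem = solve-∀

-- For u = 1, d = n and a = q^(2n+1) this is the step from n to n + 1 in horner-sum; a general u lets
-- the telescoping of the sum be proved by induction on d.
horner-step : ∀ q d u a → a * q ≡ u * (q * q) ^ suc d →
  u * horner q (suc d) u (a * (q * q)) ≡
  (1ℤ + a) * horner q d u a - (1ℤ - u) * poch q (u * (q * q)) d
    + (- a) ^ suc d * poch q (- (u * q)) (suc d) * (1ℤ + a * q)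
-- The cofactor `u + a + a * u * q` is the difference of the two sides divided by
-- `a * q - u * (q * q)`.
horner-step q zero u a h = trans (lem q u a) (drop-zero _ (u + a + a * u * q) h)
  where
  lem : ∀ q u a →
    u * ((1ℤ - u * (q * q)) * 1ℤ - a * (q * q) * (1ℤ + u * q) * 1ℤ) ≡
    (1ℤ + a) * 1ℤ - (1ℤ - u) * 1ℤ + (- a) * 1ℤ * ((1ℤ - - (u * q)) * 1ℤ) * (1ℤ + a * q)
      + (u + a + a * u * q) * (a * q - u * (q * q * 1ℤ))
  lem = solve-∀
horner-step q (suc d) u a h = begin
  u * (poch q y (suc (suc d)) - a * (q * q) * (1ℤ + u * q) * h₁)
    ≡⟨ cong (λ z → u * (z - a * (q * q) * (1ℤ + u * q) * h₁)) r₂ ⟩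
  u * ((1ℤ - y) * r * (1ℤ - a * q) - a * (q * q) * (1ℤ + u * q) * h₁)
    -- With the products and sums as unknowns, what is left over is the induction hypothesis
    -- multiplied by `- (a * (1ℤ + u * q))`.
    ≡⟨ lem₁ q u a r h₁ h₀ e w ⟩
  (1ℤ + a) * ((1ℤ - y) * r - a * (1ℤ + u * q) * h₀) - (1ℤ - u) * ((1ℤ - y) * r)
    + (- a) * (- a) ^ suc d * ((1ℤ - - (u * q)) * w) * (1ℤ + a * q)
    + (- (a * (1ℤ + u * q))) * (y * h₁ - ((1ℤ + a) * h₀ - (1ℤ - y) * r + e * w * (1ℤ + a * q)))
    ≡⟨ drop-zero _ (- (a * (1ℤ + u * q))) ih ⟩
  (1ℤ + a) * ((1ℤ - y) * r - a * (1ℤ + u * q) * h₀) - (1ℤ - u) * ((1ℤ - y) * r)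
    + (- a) * (- a) ^ suc d * ((1ℤ - - (u * q)) * w) * (1ℤ + a * q) ∎
  where
  open ≡-Reasoning
  y = u * (q * q)
  h₁ = horner q (suc d) y (a * (q * q))
  h₀ = horner q d y a
  r = poch q (y * (q * q)) d
  e = (- a) ^ suc d
  w = poch q (- (u * q) * (q * q)) (suc d)
  -- Passing from `u` to `u * (q * q)` absorbs one factor of the power, so the induction runs with
  -- `a` unchanged. The same equation turns the last factor of the Pochhammer symbol into
  -- `1ℤ - a * q` in `r₂`.
  h′ : a * q ≡ y * (q * q) ^ suc d
  h′ = trans h (sym (*-assoc u (q * q) _))
  r₂ : poch q y (suc (suc d)) ≡ (1ℤ - y) * r * (1ℤ - a * q)
  r₂ = trans (poch-last q y (suc d)) (cong (λ z → (1ℤ - y) * r * (1ℤ - z)) (sym h′))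
  swap : ∀ u q → - (u * (q * q) * q) ≡ - (u * q) * (q * q)
  swap = solve-∀
  ih : y * h₁ ≡ (1ℤ + a) * h₀ - (1ℤ - y) * r + e * w * (1ℤ + a * q)
  ih = trans (horner-step q d y a h′)
         (cong (λ z → (1ℤ + a) * h₀ - (1ℤ - y) * r + e * poch q z (suc d) * (1ℤ + a * q)) (swap u q))
  lem₁ : ∀ q u a r h₁ h₀ e w →
    u * ((1ℤ - u * (q * q)) * r * (1ℤ - a * q) - a * (q * q) * (1ℤ + u * q) * h₁) ≡
    (1ℤ + a) * ((1ℤ - u * (q * q)) * r - a * (1ℤ + u * q) * h₀) - (1ℤ - u) * ((1ℤ - u * (q * q)) * r)
      + (- a) * e * ((1ℤ - - (u * q)) * w) * (1ℤ + a * q)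
      + (- (a * (1ℤ + u * q))) * (u * (q * q) * h₁ - ((1ℤ + a) * h₀ - (1ℤ - u * (q * q)) * r + e * w * (1ℤ + a * q)))
  lem₁ = solve-∀

∑ : ℕ → (ℕ → ℤ) → ℤ
∑ zero    f = 0ℤ
∑ (suc n) f = f 0 + ∑ n (λ i → f (suc i))

∑-last : ∀ n f → ∑ (suc n) f ≡ ∑ n f + f n
∑-last zero    f = +-comm (f 0) 0ℤ
∑-last (suc n) f = trans (cong (λ z → f 0 + z) (∑-last n (λ i → f (suc i)))) (sym (+-assoc (f 0) _ _))

tri-suc : ∀ j → tri (suc j) ≡ suc j ℕ.+ tri j
tri-suc j = begin
  (suc j ℕ.* suc (suc j)) ℕ./ 2              ≡⟨ cong (ℕ._/ 2) (lem j) ⟩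
  (suc j ℕ.* 2 ℕ.+ j ℕ.* suc j) ℕ./ 2        ≡⟨ +-distrib-/-∣ˡ (j ℕ.* suc j) {2} (divides-refl (suc j)) ⟩
  suc j ℕ.* 2 ℕ./ 2 ℕ.+ tri j                ≡⟨ cong (ℕ._+ tri j) (m*n/n≡m (suc j) 2) ⟩
  suc j ℕ.+ tri j                            ∎
  where
  open ≡-Reasoning
  lem : ∀ j → suc j ℕ.* suc (suc j) ≡ suc j ℕ.* 2 ℕ.+ j ℕ.* suc j
  lem = ℕ-Solver.solve-∀

-- Written as a product so that `(- q) ^ tri (2n+1)` becomes the power `(- q^(2n+1)) ^ (n+1)`, the
-- shape of the last summand in `horner-step`.
tri-odd : ∀ n → tri (suc (n ℕ.* 2)) ≡ suc (n ℕ.* 2) ℕ.* suc n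
tri-odd n = trans (cong (ℕ._/ 2) (sym (ℕ.*-assoc (suc (n ℕ.* 2)) (suc n) 2)))
                  (m*n/n≡m (suc (n ℕ.* 2) ℕ.* suc n) 2)

sq-^ : ∀ q n → (q * q) ^ n ≡ q ^ (n ℕ.* 2)
sq-^ q zero    = refl
sq-^ q (suc n) = trans (cong (q * q *_) (sq-^ q n)) (*-assoc q q _)

^-double : ∀ q n → q ^ (n ℕ.* 2) ≡ q ^ n * q ^ n
^-double q zero    = refl
^-double q (suc n) = trans (cong (λ z → q * (q * z)) (^-double q n)) (lem q (q ^ n))
  where
  lem : ∀ q r → q * (q * (r * r)) ≡ q * r * (q * r)
  lem = solve-∀

neg-^-even : ∀ q n → (- q) ^ (n ℕ.* 2) ≡ q ^ (n ℕ.* 2)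
neg-^-even q n = trans (sym (sq-^ (- q) n)) (trans (cong (_^ n) (lem q)) (sq-^ q n))
  where
  lem : ∀ q → - q * - q ≡ q * q
  lem = solve-∀

-- Induction on `n`: a step adds the terms `j = 2n+1` and `j = 2n+2` to the sum and the factor
-- `1 + q^(2n+1)` to the product. Together they are the change that `horner-step` describes.
horner-sum : ∀ q n →
  poch q (- q) n * ∑ (suc (n ℕ.* 2)) (λ j → (- q) ^ tri j) ≡ horner q n 1ℤ (q ^ suc (n ℕ.* 2))
horner-sum q zero    = refl
horner-sum q (suc n) = begin
  poch q (- q) (suc n) * ∑ (suc (suc n ℕ.* 2)) f
    ≡⟨ cong (w *_) (trans (∑-last (suc (suc (n ℕ.* 2))) f) (cong (λ z → z + f (suc n ℕ.* 2)) (∑-last (suc (n ℕ.* 2)) f))) ⟩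
  w * (s + f (suc (n ℕ.* 2)) + f (suc n ℕ.* 2))
    -- The second new exponent exceeds the first by `2n+2`, whence the even power `a * q` of `- q`.
    ≡⟨ cong₂ (λ x y → w * (s + x + y)) f-odd f-even ⟩
  w * (s + e + a * q * e)
    ≡⟨ lem₁ w s e a q ⟩
  w * s + e * w * (1ℤ + a * q)
    ≡⟨ cong (λ z → z * s + e * w * (1ℤ + a * q)) w-last ⟩
  p * (1ℤ + a) * s + e * w * (1ℤ + a * q)
    -- The zero summand `(1ℤ - 1ℤ) * r` is inserted to match `horner-step` at `u = 1`.
    ≡⟨ lem₂ p a s r (e * w * (1ℤ + a * q)) ⟩
  (1ℤ + a) * (p * s) - (1ℤ - 1ℤ) * r + e * w * (1ℤ + a * q)
    ≡⟨ cong₂ (λ x y → (1ℤ + a) * x - (1ℤ - 1ℤ) * r + e * poch q y (suc n) * (1ℤ + a * q))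
         (horner-sum q n) (cong -_ (sym (*-identityˡ q))) ⟩
  (1ℤ + a) * horner q n 1ℤ a - (1ℤ - 1ℤ) * r + e * poch q (- (1ℤ * q)) (suc n) * (1ℤ + a * q)
    ≡⟨ horner-step q n 1ℤ a aq ⟨
  1ℤ * horner q (suc n) 1ℤ (a * (q * q))
    ≡⟨ trans (*-identityˡ _) (cong (horner q (suc n) 1ℤ) (lem₃ a q)) ⟩
  horner q (suc n) 1ℤ (q ^ suc (suc n ℕ.* 2)) ∎
  where
  open ≡-Reasoning
  f : ℕ → ℤ
  f j = (- q) ^ tri j
  a = q ^ suc (n ℕ.* 2)
  e = (- a) ^ suc n
  s = ∑ (suc (n ℕ.* 2)) f
  w = poch q (- q) (suc n)
  p = poch q (- q) n
  r = poch q (1ℤ * (q * q)) n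
  neg-a : (- q) ^ suc (n ℕ.* 2) ≡ - a
  neg-a = trans (cong (- q *_) (neg-^-even q n)) (sym (neg-distribˡ-* q _))
  f-odd : f (suc (n ℕ.* 2)) ≡ e
  f-odd = trans (cong ((- q) ^_) (tri-odd n))
            (trans (sym (^-*-assoc (- q) (suc (n ℕ.* 2)) (suc n))) (cong (_^ suc n) neg-a))
  f-even : f (suc n ℕ.* 2) ≡ a * q * e
  f-even = trans (cong ((- q) ^_) (tri-suc (suc (n ℕ.* 2))))
             (trans (^-distribˡ-+-* (- q) (suc n ℕ.* 2) (tri (suc (n ℕ.* 2))))
               (cong₂ _*_ (trans (cong (- q *_) neg-a) (lem q a)) f-odd))
    where
    lem : ∀ q a → - q * - a ≡ a * q
    lem = solve-∀
  w-last : w ≡ p * (1ℤ + a)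
  w-last = trans (poch-last q (- q) n) (cong (p *_) (trans (lem q _) (cong (λ z → 1ℤ + q * z) (sq-^ q n))))
    where
    lem : ∀ q r → 1ℤ - - q * r ≡ 1ℤ + q * r
    lem = solve-∀
  aq : a * q ≡ 1ℤ * (q * q) ^ suc n
  aq = trans (lem q _) (cong (λ z → 1ℤ * (q * q * z)) (sym (sq-^ q n)))
    where
    lem : ∀ q r → q * r * q ≡ 1ℤ * (q * q * r)
    lem = solve-∀
  lem₁ : ∀ w s e a q → w * (s + e + a * q * e) ≡ w * s + e * w * (1ℤ + a * q)
  lem₁ = solve-∀
  lem₂ : ∀ p a s r x → p * (1ℤ + a) * s + x ≡ (1ℤ + a) * (p * s) - (1ℤ - 1ℤ) * r + x
  lem₂ = solve-∀
  lem₃ : ∀ a q → a * (q * q) ≡ q * (q * a)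
  lem₃ = solve-∀

-- By `(1 + x) (1 - x) = 1 - x²`, the factors with exponents `2i+1` and `2i+2` yield `1 - q^(4i+2)`
-- and `1 - q^(4i+4)`. Once the tails are negligible, cancelling `poch q (q * q) n` gives Euler's
-- theorem on distinct and odd parts, in `q²`.
poch-product : ∀ q n →
  poch q (- q) n * poch q q n * (poch q (- (q * q)) n * poch q (q * q) n) ≡ poch q (q * q) (n ℕ.* 2)
poch-product q zero    = refl
poch-product q (suc n) = begin
  poch q (- q) (suc n) * poch q q (suc n) * (poch q (- (q * q)) (suc n) * poch q (q * q) (suc n))
    ≡⟨ cong₂ _*_ (cong₂ _*_ (poch-last q (- q) n) (poch-last q q n))
                 (cong₂ _*_ (poch-last q (- (q * q)) n) (poch-last q (q * q) n)) ⟩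
  _ ≡⟨ lem (poch q (- q) n) (poch q q n) (poch q (- (q * q)) n) (poch q (q * q) n) q r ⟩
  poch q (- q) n * poch q q n * (poch q (- (q * q)) n * poch q (q * q) n)
    * (1ℤ - q * q * (r * r)) * (1ℤ - q * q * (q * q * (r * r)))
    ≡⟨ cong₂ (λ x y → x * (1ℤ - q * q * y) * (1ℤ - q * q * (q * q * y)))
         (poch-product q n) (sym (^-double (q * q) n)) ⟩
  poch q (q * q) (n ℕ.* 2) * (1ℤ - q * q * (q * q) ^ (n ℕ.* 2)) * (1ℤ - q * q * (q * q) ^ suc (n ℕ.* 2))
    ≡⟨ cong (_* (1ℤ - q * q * (q * q) ^ suc (n ℕ.* 2))) (poch-last q (q * q) (n ℕ.* 2)) ⟨
  poch q (q * q) (suc (n ℕ.* 2)) * (1ℤ - q * q * (q * q) ^ suc (n ℕ.* 2))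
    ≡⟨ poch-last q (q * q) (suc (n ℕ.* 2)) ⟨
  poch q (q * q) (suc n ℕ.* 2) ∎
  where
  open ≡-Reasoning
  r = (q * q) ^ n
  lem : ∀ a b c d q r →
    a * (1ℤ - - q * r) * (b * (1ℤ - q * r)) * (c * (1ℤ - - (q * q) * r) * (d * (1ℤ - q * q * r))) ≡
    a * b * (c * d) * (1ℤ - q * q * (r * r)) * (1ℤ - q * q * (q * q * (r * r)))
  lem = solve-∀

-- Congruences modulo a power of `q`.

module Mod (M : ℤ) where

  infix 4 _≈_
  -- The quotient is kept as data: matching on the equation eliminates one side, and each law
  -- becomes a ring identity with an explicit new quotient.
  record _≈_ (x y : ℤ) : Set where
    constructor by
    field
      quotient : ℤ
      equality : x ≡ y + quotient * M

  ≈-reflexive : ∀ {x y} → x ≡ y → x ≈ y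
  ≈-reflexive {x} refl = by 0ℤ (lem x M)
    where
    lem : ∀ x m → x ≡ x + 0ℤ * m
    lem = solve-∀

  ≈-refl : ∀ {x} → x ≈ x
  ≈-refl = ≈-reflexive refl

  ≈-sym : ∀ {x y} → x ≈ y → y ≈ x
  ≈-sym {x} {y} (by s refl) = by (- s) (lem y s M)
    where
    lem : ∀ y s m → y ≡ y + s * m + - s * m
    lem = solve-∀

  ≈-trans : ∀ {x y z} → x ≈ y → y ≈ z → x ≈ z
  ≈-trans {z = z} (by s refl) (by t refl) = by (t + s) (lem z s t M)
    where
    lem : ∀ z s t m → z + t * m + s * m ≡ z + (t + s) * m
    lem = solve-∀

  ≈-setoid : Setoid _ _
  ≈-setoid = record { Carrier = ℤ ; _≈_ = _≈_
    ; isEquivalence = record { refl = ≈-refl ; sym = ≈-sym ; trans = ≈-trans } }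

  +-cong : ∀ {x y u v} → x ≈ y → u ≈ v → x + u ≈ y + v
  +-cong {y = y} {v = v} (by s refl) (by t refl) = by (s + t) (lem y v s t M)
    where
    lem : ∀ y v s t m → y + s * m + (v + t * m) ≡ y + v + (s + t) * m
    lem = solve-∀

  *-cong : ∀ {x y u v} → x ≈ y → u ≈ v → x * u ≈ y * v
  *-cong {y = y} {v = v} (by s refl) (by t refl) = by (s * (v + t * M) + y * t) (lem y v s t M)
    where
    lem : ∀ y v s t m → (y + s * m) * (v + t * m) ≡ y * v + (s * (v + t * m) + y * t) * m
    lem = solve-∀

  *-congˡ : ∀ x {y z} → y ≈ z → x * y ≈ x * z
  *-congˡ x = *-cong (≈-refl {x})

  *-congʳ : ∀ x {y z} → y ≈ z → y * x ≈ z * x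
  *-congʳ x y≈z = *-cong y≈z (≈-refl {x})

module _ (q : ℤ) (n : ℕ) where

  open Mod (q ^ suc (n ℕ.* 2))

  -- The extra factors are `1 - q^(2i)` with `i > n`, and `2i ≥ 2n+2` makes each of them 1 modulo
  -- `q^(2n+1)`.
  poch-tail : ∀ d → poch q (q * q) (d ℕ.+ n) ≈ poch q (q * q) n
  poch-tail zero    = ≈-refl
  poch-tail (suc d) = begin
    poch q (q * q) (suc (d ℕ.+ n))
      ≡⟨ poch-last q (q * q) (d ℕ.+ n) ⟩
    poch q (q * q) (d ℕ.+ n) * (1ℤ - q * q * (q * q) ^ (d ℕ.+ n))
      ≈⟨ *-cong (poch-tail d) (by (- (q * (q * q) ^ d)) factor) ⟩
    poch q (q * q) n * 1ℤ
      ≡⟨ *-identityʳ _ ⟩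
    poch q (q * q) n ∎
    where
    open Relation.Binary.Reasoning.Setoid ≈-setoid
    factor : 1ℤ - q * q * (q * q) ^ (d ℕ.+ n) ≡ 1ℤ + - (q * (q * q) ^ d) * q ^ suc (n ℕ.* 2)
    factor = trans (cong (λ z → 1ℤ - q * q * z)
                 (trans (^-distribˡ-+-* (q * q) d n) (cong ((q * q) ^ d *_) (sq-^ q n))))
               (lem q ((q * q) ^ d) (q ^ (n ℕ.* 2)))
      where
      lem : ∀ q r s → 1ℤ - q * q * (r * s) ≡ 1ℤ + - (q * r) * (q * s)
      lem = solve-∀

  -- All summands of `horner` after the first carry the factor `a`, which here is the modulus.
  horner-≈ : ∀ d u → horner q d u (q ^ suc (n ℕ.* 2)) ≈ poch q (u * (q * q)) d
  horner-≈ zero    u = ≈-refl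
  horner-≈ (suc d) u = by (- ((1ℤ + u * q) * h)) (lem (poch q (u * (q * q)) (suc d)) (q ^ suc (n ℕ.* 2)) (1ℤ + u * q) h)
    where
    h = horner q d (u * (q * q)) (q ^ suc (n ℕ.* 2))
    lem : ∀ x a y z → x - a * y * z ≡ x + - (y * z) * a
    lem = solve-∀

  -- This is ψ(-q) P(q) = ∏ (1 + q^(2i)) modulo `q^(2n+1)`, with `p` for the value of P. Gauss gives
  -- `O * ψ ≈ Q`, Euler gives `O * U * d ≈ 1ℤ`, and the hypothesis makes `p` an inverse of `U * Q`.
  triangular-≈ : ∀ p →
    p * (poch q q n * poch q (q * q) n) ≈ 1ℤ →
    ∑ (suc (n ℕ.* 2)) (λ j → (- q) ^ tri j) * p ≈ poch q (- (q * q)) n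
  triangular-≈ p inv = begin
    ψ * p                     ≡⟨ *-identityʳ _ ⟨
    ψ * p * 1ℤ                ≈⟨ *-congˡ (ψ * p) OUd≈1 ⟨
    ψ * p * (O * U * d)       ≡⟨ lem₁ ψ p O U d ⟩
    d * (O * ψ * (p * U))     ≈⟨ *-congˡ d (*-congʳ (p * U) Oψ≈Q) ⟩
    d * (Q * (p * U))         ≡⟨ cong (d *_) (lem₂ Q p U) ⟩
    d * (p * (U * Q))         ≈⟨ *-congˡ d inv ⟩
    d * 1ℤ                    ≡⟨ *-identityʳ d ⟩
    d                         ∎
    where
    open Relation.Binary.Reasoning.Setoid ≈-setoid
    ψ = ∑ (suc (n ℕ.* 2)) (λ j → (- q) ^ tri j)
    O = poch q (- q) n
    U = poch q q n
    Q = poch q (q * q) n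
    d = poch q (- (q * q)) n
    lem₁ : ∀ ψ p O U d → ψ * p * (O * U * d) ≡ d * (O * ψ * (p * U))
    lem₁ = solve-∀
    lem₂ : ∀ Q p U → Q * (p * U) ≡ p * (U * Q)
    lem₂ = solve-∀
    lem₃ : ∀ O U d p Q → O * U * d * (p * (U * Q)) ≡ p * U * (O * U * (d * Q))
    lem₃ = solve-∀
    Oψ≈Q : O * ψ ≈ Q
    Oψ≈Q = begin
      O * ψ                                 ≡⟨ horner-sum q n ⟩
      horner q n 1ℤ (q ^ suc (n ℕ.* 2))     ≈⟨ horner-≈ n 1ℤ ⟩
      poch q (1ℤ * (q * q)) n               ≡⟨ cong (λ z → poch q z n) (*-identityˡ (q * q)) ⟩
      Q                                     ∎
    OUdQ≈Q : O * U * (d * Q) ≈ Q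
    OUdQ≈Q = begin
      O * U * (d * Q)              ≡⟨ poch-product q n ⟩
      poch q (q * q) (n ℕ.* 2)     ≡⟨ cong (poch q (q * q)) (lem n) ⟩
      poch q (q * q) (n ℕ.+ n)     ≈⟨ poch-tail n ⟩
      Q                            ∎
      where
      lem : ∀ n → n ℕ.* 2 ≡ n ℕ.+ n
      lem = ℕ-Solver.solve-∀
    -- Division by `Q` is replaced by multiplication with `p * (U * Q) ≈ 1ℤ`, after which `OUdQ≈Q`
    -- applies.
    OUd≈1 : O * U * d ≈ 1ℤ
    OUd≈1 = begin
      O * U * d                     ≡⟨ *-identityʳ _ ⟨
      O * U * d * 1ℤ                ≈⟨ *-congˡ (O * U * d) inv ⟨
      O * U * d * (p * (U * Q))     ≡⟨ lem₃ O U d p Q ⟩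
      p * U * (O * U * (d * Q))     ≈⟨ *-congˡ (p * U) OUdQ≈Q ⟩
      p * U * Q                     ≡⟨ *-assoc p U Q ⟩
      p * (U * Q)                   ≈⟨ inv ⟩
      1ℤ                            ∎

-- Finite sums and shifts of coefficient sequences.

∑-cong : ∀ n {f g} → (∀ i → f i ≡ g i) → ∑ n f ≡ ∑ n g
∑-cong zero    f≗g = refl
∑-cong (suc n) f≗g = cong₂ _+_ (f≗g 0) (∑-cong n (f≗g ∘ suc))

∑-zero : ∀ n {f} → (∀ i → f i ≡ 0ℤ) → ∑ n f ≡ 0ℤ
∑-zero zero    f≗0 = refl
∑-zero (suc n) f≗0 = cong₂ _+_ (f≗0 0) (∑-zero n (f≗0 ∘ suc))

∑-extend : ∀ {m n f} → m ℕ.≤ n → (∀ i → m ℕ.≤ i → f i ≡ 0ℤ) → ∑ n f ≡ ∑ m f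
∑-extend {n = n} z≤n       f≗0 = ∑-zero n (λ i → f≗0 i z≤n)
∑-extend {f = f} (s≤s m≤n) f≗0 = cong (λ z → f 0 + z) (∑-extend m≤n (λ i m≤i → f≗0 (suc i) (s≤s m≤i)))

∑-+ : ∀ n f g → ∑ n (λ i → f i + g i) ≡ ∑ n f + ∑ n g
∑-+ zero    f g = refl
∑-+ (suc n) f g = trans (cong (λ z → f 0 + g 0 + z) (∑-+ n (f ∘ suc) (g ∘ suc))) (lem (f 0) (g 0) _ _)
  where
  lem : ∀ a b c d → a + b + (c + d) ≡ a + c + (b + d)
  lem = solve-∀

-- The coefficients of q^k · f(q).
shift : ℕ → (ℕ → ℤ) → ℕ → ℤ
shift zero    f m       = f m
shift (suc k) f zero    = 0ℤ
shift (suc k) f (suc m) = shift k f m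

shift-cong : ∀ k m {f g} → (∀ i → k ℕ.+ i ≡ m → f i ≡ g i) → shift k f m ≡ shift k g m
shift-cong zero    m       f≗g = f≗g m refl
shift-cong (suc k) zero    f≗g = refl
shift-cong (suc k) (suc m) f≗g = shift-cong k m (λ i eq → f≗g i (cong suc eq))

shift-≤ : ∀ {k m} f → k ℕ.≤ m → shift k f m ≡ f (m ℕ.∸ k)
shift-≤ f z≤n       = refl
shift-≤ f (s≤s k≤m) = shift-≤ f k≤m

shift-> : ∀ {k m} f → m ℕ.< k → shift k f m ≡ 0ℤ
shift-> {suc k} {zero}  f _         = refl
shift-> {suc k} {suc m} f (s≤s m<k) = shift-> f m<k

shift-+ : ∀ k l f m → shift (k ℕ.+ l) f m ≡ shift k (shift l f) m
shift-+ zero    l f m       = refl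
shift-+ (suc k) l f zero    = refl
shift-+ (suc k) l f (suc m) = shift-+ k l f m

shift-comm : ∀ k l f m → shift k (shift l f) m ≡ shift l (shift k f) m
shift-comm k l f m = trans (sym (shift-+ k l f m))
  (trans (cong (λ z → shift z f m) (ℕ.+-comm k l)) (shift-+ l k f m))

shift-∑ : ∀ k n (f : ℕ → ℕ → ℤ) m → shift k (λ i → ∑ n (λ c → f c i)) m ≡ ∑ n (λ c → shift k (f c) m)
shift-∑ zero    n f m       = refl
shift-∑ (suc k) n f zero    = sym (∑-zero n (λ _ → refl))
shift-∑ (suc k) n f (suc m) = shift-∑ k n f m

-- Values of truncated series.

-- Horner form, so that removing the constant coefficient and dividing by `q` leaves the value of
-- the tail, as the induction in `coefficients-unique` requires.
eval : ℤ → ℕ → (ℕ → ℤ) → ℤ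
eval q zero    f = 0ℤ
eval q (suc N) f = f 0 + q * eval q N (f ∘ suc)

eval-last : ∀ q N f → eval q (suc N) f ≡ eval q N f + f N * q ^ N
eval-last q zero f = lem (f 0) q
  where
  lem : ∀ x q → x + q * 0ℤ ≡ 0ℤ + x * 1ℤ
  lem = solve-∀
eval-last q (suc N) f = trans (cong (λ z → f 0 + q * z) (eval-last q N (f ∘ suc))) (lem (f 0) q _ (f (suc N)) (q ^ N))
  where
  lem : ∀ x q y z r → x + q * (y + z * r) ≡ x + q * y + z * (q * r)
  lem = solve-∀

eval-cong : ∀ q N {f g} → (∀ i → f i ≡ g i) → eval q N f ≡ eval q N g
eval-cong q zero    f≗g = refl
eval-cong q (suc N) f≗g = cong₂ (λ x y → x + q * y) (f≗g 0) (eval-cong q N (f≗g ∘ suc))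

eval-0 : ∀ q N → eval q N (λ _ → 0ℤ) ≡ 0ℤ
eval-0 q zero    = refl
eval-0 q (suc N) = trans (+-identityˡ _) (trans (cong (q *_) (eval-0 q N)) (*-zeroʳ q))

eval-+ : ∀ q N f g → eval q N (λ i → f i + g i) ≡ eval q N f + eval q N g
eval-+ q zero    f g = refl
eval-+ q (suc N) f g = trans (cong (λ z → f 0 + g 0 + q * z) (eval-+ q N (f ∘ suc) (g ∘ suc)))
                             (lem (f 0) (g 0) q _ _)
  where
  lem : ∀ x y q a b → x + y + q * (a + b) ≡ x + q * a + (y + q * b)
  lem = solve-∀

eval-* : ∀ q N c f → eval q N (λ i → c * f i) ≡ c * eval q N f
eval-* q zero    c f = sym (*-zeroʳ c)
eval-* q (suc N) c f = trans (cong (λ z → c * f 0 + q * z) (eval-* q N c (f ∘ suc))) (lem c (f 0) q _)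
  where
  lem : ∀ c x q a → c * x + q * (c * a) ≡ c * (x + q * a)
  lem = solve-∀

module _ (q : ℤ) (N : ℕ) where

  open Mod (q ^ suc N)

  -- Each shift by one pushes a single coefficient out of the truncation, and its term is a multiple
  -- of `q^(N+1)`.
  eval-shift : ∀ k f → eval q (suc N) (shift k f) ≈ q ^ k * eval q (suc N) f
  eval-shift zero    f = ≈-reflexive (sym (*-identityˡ _))
  eval-shift (suc k) f = begin
    0ℤ + q * eval q N (shift k f)
      ≈⟨ ≈-sym (by (shift k f N) (trans (cong (q *_) (eval-last q N (shift k f))) (lem q _ (shift k f N) (q ^ N)))) ⟩
    q * eval q (suc N) (shift k f)
      ≈⟨ *-congˡ q (eval-shift k f) ⟩
    q * (q ^ k * eval q (suc N) f)
      ≡⟨ *-assoc q (q ^ k) _ ⟨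
    q ^ suc k * eval q (suc N) f ∎
    where
    open Relation.Binary.Reasoning.Setoid ≈-setoid
    lem : ∀ q a b r → q * (a + b * r) ≡ 0ℤ + q * a + b * (q * r)
    lem = solve-∀

  -- Takes the place of multiplication of series: one factor is always a sum of signed powers of
  -- `q`, so shifts replace convolution.
  eval-∑ : ∀ J (s : ℕ → ℤ) (t : ℕ → ℕ) f →
    eval q (suc N) (λ m → ∑ J (λ j → s j * shift (t j) f m)) ≈ ∑ J (λ j → s j * q ^ t j) * eval q (suc N) f
  eval-∑ zero    s t f = ≈-reflexive (eval-0 q (suc N))
  eval-∑ (suc J) s t f = begin
    eval q (suc N) (λ m → s 0 * shift (t 0) f m + rest m)
      ≡⟨ eval-+ q (suc N) (λ m → s 0 * shift (t 0) f m) rest ⟩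
    eval q (suc N) (λ m → s 0 * shift (t 0) f m) + eval q (suc N) rest
      ≈⟨ +-cong (≈-trans (≈-reflexive (eval-* q (suc N) (s 0) (shift (t 0) f))) (*-congˡ (s 0) (eval-shift (t 0) f)))
                (eval-∑ J (s ∘ suc) (t ∘ suc) f) ⟩
    s 0 * (q ^ t 0 * F) + S * F
      ≡⟨ lem (s 0) (q ^ t 0) F S ⟩
    (s 0 * q ^ t 0 + S) * F ∎
    where
    open Relation.Binary.Reasoning.Setoid ≈-setoid
    rest : ℕ → ℤ
    rest m = ∑ J (λ j → s (suc j) * shift (t (suc j)) f m)
    F = eval q (suc N) f
    S = ∑ J (λ j → s (suc j) * q ^ t (suc j))
    lem : ∀ a b x y → a * (b * x) + y * x ≡ (a * b + y) * x
    lem = solve-∀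

-- Recovering coefficients from values.

open Mod using (by)

multiple-<⇒0 : ∀ {i j k} → i ≡ j * k → ∣ i ∣ ℕ.< ∣ j ∣ → i ≡ 0ℤ
multiple-<⇒0 {i} {j} {k} i≡jk i<j = ∣i∣≡0⇒i≡0 (lem ∣ k ∣ (trans (cong ∣_∣ i≡jk) (abs-* j k)))
  where
  lem : ∀ c → ∣ i ∣ ≡ ∣ j ∣ ℕ.* c → ∣ i ∣ ≡ 0
  lem zero    eq = trans eq (ℕ.*-zeroʳ ∣ j ∣)
  lem (suc c) eq = contradiction (ℕ.≤-trans (ℕ.m≤m*n ∣ j ∣ (suc c)) (ℕ.≤-reflexive (sym eq))) (ℕ.<⇒≱ i<j)

-- The constant coefficients differ by a multiple of every q, so they agree; divide by q and repeat.
coefficients-unique : ∀ N f g →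
  (∀ k → let open Mod ((+ suc k) ^ N) in eval (+ suc k) N f ≈ eval (+ suc k) N g) →
  ∀ i → i ℕ.< N → f i ≡ g i
coefficients-unique (suc N) f g h = go
  where
  head : f 0 ≡ g 0
  -- The base `q = ∣ f 0 - g 0 ∣ + 1` is larger than the difference that it divides, so the
  -- difference is zero.
  head = i-j≡0⇒i≡j (f 0) (g 0) (lem₂ (h ∣ f 0 - g 0 ∣))
    where
    q = + suc ∣ f 0 - g 0 ∣
    open Mod (q ^ suc N)
    lem₁ : ∀ x y a b q t r → x + q * a ≡ y + q * b + t * (q * r) → x - y ≡ q * (b + t * r - a)
    lem₁ x y a b q t r eq = trans (l₁ x y (q * a)) (trans (cong (λ z → z - q * a - y) eq) (l₂ y a b q t r))
      where
      l₁ : ∀ x y c → x - y ≡ x + c - c - y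
      l₁ = solve-∀
      l₂ : ∀ y a b q t r → y + q * b + t * (q * r) - q * a - y ≡ q * (b + t * r - a)
      l₂ = solve-∀
    lem₂ : eval q (suc N) f ≈ eval q (suc N) g → f 0 - g 0 ≡ 0ℤ
    lem₂ (by t eq) = multiple-<⇒0 {j = q} (lem₁ (f 0) (g 0) _ _ q t (q ^ N) eq) ℕ.≤-refl
  tail : ∀ k → let open Mod ((+ suc k) ^ N) in eval (+ suc k) N (f ∘ suc) ≈ eval (+ suc k) N (g ∘ suc)
  tail k with h k
  ... | by t eq = by t (*-cancelˡ-≡ q _ _ (∙-cancelˡ (f 0) _ _
          (trans eq (trans (cong (λ z → z + q * eval q N (g ∘ suc) + t * (q * q ^ N)) (sym head))
                           (lem (f 0) q _ t (q ^ N))))))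
    where
    q = + suc k
    lem : ∀ x q b t r → x + q * b + t * (q * r) ≡ x + q * (b + t * r)
    lem = solve-∀
  go : ∀ i → i ℕ.< suc N → f i ≡ g i
  go zero    _         = head
  go (suc i) (s≤s i<N) = coefficients-unique N (f ∘ suc) (g ∘ suc) tail i i<N

-- Weighted sums over lists.

sumℤ-++ : ∀ xs ys → sumℤ (xs ++ ys) ≡ sumℤ xs + sumℤ ys
sumℤ-++ []       ys = sym (+-identityˡ (sumℤ ys))
sumℤ-++ (x ∷ xs) ys = trans (cong (λ z → x + z) (sumℤ-++ xs ys)) (sym (+-assoc x (sumℤ xs) (sumℤ ys)))

sumℤ-concatMap : ∀ {A B : Set} (w : B → ℤ) (F : A → List B) xs →
  sumℤ (map w (concatMap F xs)) ≡ sumℤ (map (λ x → sumℤ (map w (F x))) xs)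
sumℤ-concatMap w F []       = refl
sumℤ-concatMap w F (x ∷ xs) = trans (cong sumℤ (map-++ w (F x) (concatMap F xs)))
  (trans (sumℤ-++ (map w (F x)) _) (cong (λ z → sumℤ (map w (F x)) + z) (sumℤ-concatMap w F xs)))

sumℤ-cong : ∀ {A : Set} {f g : A → ℤ} {xs} → All (λ x → f x ≡ g x) xs → sumℤ (map f xs) ≡ sumℤ (map g xs)
sumℤ-cong []         = refl
sumℤ-cong (eq ∷ eqs) = cong₂ _+_ eq (sumℤ-cong eqs)

sumℤ-∑ : ∀ {A : Set} n (F : ℕ → A → ℤ) xs →
  sumℤ (map (λ x → ∑ n (λ j → F j x)) xs) ≡ ∑ n (λ j → sumℤ (map (F j) xs))
sumℤ-∑ n F []       = sym (∑-zero n (λ _ → refl))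
sumℤ-∑ n F (x ∷ xs) = trans (cong (λ z → ∑ n (λ j → F j x) + z) (sumℤ-∑ n F xs))
  (sym (∑-+ n (λ j → F j x) (λ j → sumℤ (map (F j) xs))))

sumℤ-+sum : ∀ {A : Set} (f : A → ℕ) xs → + sum (map f xs) ≡ sumℤ (map (λ x → + f x) xs)
sumℤ-+sum f []       = refl
sumℤ-+sum f (x ∷ xs) = trans (pos-+ (f x) _) (cong (λ z → + f x + z) (sumℤ-+sum f xs))

sumℤ-upTo : ∀ f n → sumℤ (map f (upTo n)) ≡ ∑ n f
sumℤ-upTo f n = trans (cong sumℤ (map-upTo f n)) (go f n)
  where
  go : ∀ f n → sumℤ (applyUpTo f n) ≡ ∑ n f
  go f zero    = refl
  go f (suc n) = cong (λ z → f 0 + z) (go (f ∘ suc) n)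

-- Serves to trade the filter in `partsUpTo` for the zeros of `shift` below its offset.
sumℤ-filter : ∀ {A : Set} {P : A → Set} (P? : ∀ x → Dec (P x)) {f h : A → ℤ} →
  (∀ x → P x → f x ≡ h x) → (∀ x → ¬ P x → h x ≡ 0ℤ) →
  ∀ xs → sumℤ (map f (filter P? xs)) ≡ sumℤ (map h xs)
sumℤ-filter P? yes-eq no-eq [] = refl
sumℤ-filter P? {h = h} yes-eq no-eq (x ∷ xs) with P? x
... | yes px = cong₂ _+_ (yes-eq x px) (sumℤ-filter P? yes-eq no-eq xs)
... | no ¬px = trans (sumℤ-filter P? yes-eq no-eq xs)
                 (sym (trans (cong (λ z → z + sumℤ (map h xs)) (no-eq x ¬px)) (+-identityˡ _)))

indicator : ∀ {P : Set} → Dec P → ℤ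
indicator (yes _) = 1ℤ
indicator (no _)  = 0ℤ

indicator-yes : ∀ {P : Set} (P? : Dec P) → P → indicator P? ≡ 1ℤ
indicator-yes (yes _) _ = refl
indicator-yes (no ¬p) p = contradiction p ¬p

indicator-no : ∀ {P : Set} (P? : Dec P) → ¬ P → indicator P? ≡ 0ℤ
indicator-no (yes p) ¬p = contradiction p ¬p
indicator-no (no _)  _  = refl

indicator-⇔ : ∀ {P Q : Set} (P? : Dec P) (Q? : Dec Q) → (P → Q) → (Q → P) → indicator P? ≡ indicator Q?
indicator-⇔ (yes p) Q? to from = sym (indicator-yes Q? (to p))
indicator-⇔ (no ¬p) Q? to from = sym (indicator-no Q? (¬p ∘ from))

length-filter : ∀ {A : Set} {P : A → Set} (P? : ∀ x → Dec (P x)) xs →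
  + length (filter P? xs) ≡ sumℤ (map (λ x → indicator (P? x)) xs)
length-filter P? [] = refl
length-filter P? (x ∷ xs) with P? x
... | yes _ = trans (pos-+ 1 _) (cong (λ z → 1ℤ + z) (length-filter P? xs))
... | no _  = trans (length-filter P? xs) (sym (+-identityˡ _))

-- Partition series by multiplicity of the largest part.

-- The coefficients of Σ_c q^(c(k+1)) · g_c(q).
multiples : ℕ → (ℕ → ℕ → ℤ) → ℕ → ℤ
multiples k g m = ∑ (suc m) (λ c → shift (c ℕ.* suc k) (g c) m)

-- For `c > m` the offset `c * suc k` is at least `c` and so exceeds `m`.
multiples-extend : ∀ k g {m n} → m ℕ.< n → ∑ n (λ c → shift (c ℕ.* suc k) (g c) m) ≡ multiples k g m
multiples-extend k g m<n = ∑-extend m<n (λ c m<c → shift-> (g c) (ℕ.<-≤-trans m<c (ℕ.m≤m*n c (suc k))))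

-- Multiplicity zero of the part `k+1` is set apart, and one copy is split off from every positive
-- multiplicity. The recurrences below come from this.
multiples-suc : ∀ k g m → multiples k g m ≡ g 0 m + shift (suc k) (multiples k (g ∘ suc)) m
multiples-suc k g m = cong (λ z → g 0 m + z) (begin
  ∑ m (λ c → shift (suc k ℕ.+ c ℕ.* suc k) (g (suc c)) m)
    ≡⟨ ∑-cong m (λ c → shift-+ (suc k) (c ℕ.* suc k) (g (suc c)) m) ⟩
  ∑ m (λ c → shift (suc k) (shift (c ℕ.* suc k) (g (suc c))) m)
    ≡⟨ shift-∑ (suc k) m (λ c → shift (c ℕ.* suc k) (g (suc c))) m ⟨
  shift (suc k) (λ i → ∑ m (λ c → shift (c ℕ.* suc k) (g (suc c)) i)) m
    -- From `suc k + i = m` follows `i < m`, so `m` summands are enough for the coefficient at `i`.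
    ≡⟨ shift-cong (suc k) m (λ i eq → multiples-extend k (g ∘ suc)
         (ℕ.≤-trans (s≤s (ℕ.m≤n+m i k)) (ℕ.≤-reflexive eq))) ⟩
  shift (suc k) (multiples k (g ∘ suc)) m ∎)
  where open ≡-Reasoning

multiples-cong : ∀ k {g h} m → (∀ c i → g c i ≡ h c i) → multiples k g m ≡ multiples k h m
multiples-cong k m g≗h = ∑-cong (suc m) (λ c → shift-cong (c ℕ.* suc k) m (λ i _ → g≗h c i))

multiples-shift : ∀ k t g m → multiples k (λ c → shift t (g c)) m ≡ shift t (multiples k g) m
multiples-shift k t g m = begin
  ∑ (suc m) (λ c → shift (c ℕ.* suc k) (shift t (g c)) m)
    ≡⟨ ∑-cong (suc m) (λ c → shift-comm (c ℕ.* suc k) t (g c) m) ⟩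
  ∑ (suc m) (λ c → shift t (shift (c ℕ.* suc k) (g c)) m)
    ≡⟨ shift-∑ t (suc m) (λ c → shift (c ℕ.* suc k) (g c)) m ⟨
  shift t (λ i → ∑ (suc m) (λ c → shift (c ℕ.* suc k) (g c) i)) m
    ≡⟨ shift-cong t m (λ i eq → multiples-extend k g
         (s≤s (ℕ.≤-trans (ℕ.m≤n+m i t) (ℕ.≤-reflexive eq)))) ⟩
  shift t (multiples k g) m ∎
  where open ≡-Reasoning

-- One weighted count for all purposes: the weight 1 gives all partitions, `unique` those into
-- distinct parts, `covers j` those with mex above `j`.
total : (List ℕ → ℤ) → ℕ → ℕ → ℤ
total w k m = sumℤ (map w (partsUpTo k m))

total-suc : ∀ w k m → total w (suc k) m ≡ multiples k (λ c → total (w ∘ (replicate c (suc k) ++_)) k) m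
total-suc w k m = begin
  sumℤ (map w (concatMap F cs))               ≡⟨ sumℤ-concatMap w F cs ⟩
  sumℤ (map (λ c → sumℤ (map w (F c))) cs)    ≡⟨ sumℤ-filter (λ c → c ℕ.* suc k ℕ.≤? m)
                                                    (λ c c≤ → trans (cong sumℤ (sym (map-∘ (partsUpTo k (m ℕ.∸ c ℕ.* suc k)))))
                                                                    (sym (shift-≤ (g c) c≤)))
                                                    (λ c c≰ → shift-> (g c) (ℕ.≰⇒> c≰)) (upTo (suc m)) ⟩
  sumℤ (map G (upTo (suc m)))                 ≡⟨ sumℤ-upTo G (suc m) ⟩
  ∑ (suc m) G                                 ∎
  where
  open ≡-Reasoning
  F : ℕ → List (List ℕ)
  F c = map (replicate c (suc k) ++_) (partsUpTo k (m ℕ.∸ c ℕ.* suc k))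
  cs : List ℕ
  cs = filter (λ c → c ℕ.* suc k ℕ.≤? m) (upTo (suc m))
  g : ℕ → ℕ → ℤ
  g c = total (w ∘ (replicate c (suc k) ++_)) k
  G : ℕ → ℤ
  G c = shift (c ℕ.* suc k) (g c) m

parts-≤ : ∀ k m → All (All (ℕ._≤ k)) (partsUpTo k m)
parts-≤ zero    zero    = [] ∷ []
parts-≤ zero    (suc m) = []
parts-≤ (suc k) m       = All.concat⁺ (All.map⁺ (All.universal
  (λ c → All.map⁺ (All.map (λ μ≤k → All.++⁺ (All.replicate⁺ c ℕ.≤-refl) (All.map ℕ.m≤n⇒m≤1+n μ≤k))
                           (parts-≤ k (m ℕ.∸ c ℕ.* suc k))))
  (filter (λ c → c ℕ.* suc k ℕ.≤? m) (upTo (suc m)))))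

total-cong : ∀ {w w′} k m → (∀ {μ} → All (ℕ._≤ k) μ → w μ ≡ w′ μ) → total w k m ≡ total w′ k m
total-cong k m w≗w′ = sumℤ-cong (All.map w≗w′ (parts-≤ k m))

total-zero : ∀ {w} k m → (∀ {μ} → All (ℕ._≤ k) μ → w μ ≡ 0ℤ) → total w k m ≡ 0ℤ
total-zero k m w≗0 = trans (total-cong k m w≗0) (go (partsUpTo k m))
  where
  go : ∀ (xs : List (List ℕ)) → sumℤ (map (λ _ → 0ℤ) xs) ≡ 0ℤ
  go []       = refl
  go (_ ∷ xs) = trans (+-identityˡ _) (go xs)

-- Parts larger than `m` do not occur in partitions of `m`, so a single bound `k` can serve for all
-- `m ≤ k`, although `partitions m` uses the bound `m`.
stable : (T : ℕ → ℕ → ℤ) → (∀ k m → m ℕ.≤ k → T (suc k) m ≡ T k m) → ∀ {k m} → m ℕ.≤ k → T k m ≡ T m m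
stable T step {k} {m} m≤k = trans (cong (λ z → T z m) (sym (ℕ.m∸n+n≡m m≤k))) (go (k ℕ.∸ m))
  where
  go : ∀ d → T (d ℕ.+ m) m ≡ T m m
  go zero    = refl
  go (suc d) = trans (step (d ℕ.+ m) m (ℕ.m≤n+m m d)) (go d)

-- All partitions and partitions into distinct parts.

p : ℕ → ℕ → ℤ
p = total (λ _ → 1ℤ)

-- A partition lacks the part `k+1`, or one copy of it can be removed and the bound `k+1` remains.
-- As series, P_k = (1 - q^(k+1)) P_(k+1).
p-suc : ∀ k m → p (suc k) m ≡ p k m + shift (suc k) (p (suc k)) m
p-suc k m = begin
  p (suc k) m                                                ≡⟨ total-suc (λ _ → 1ℤ) k m ⟩
  multiples k (λ _ → p k) m                                  ≡⟨ multiples-suc k (λ _ → p k) m ⟩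
  p k m + shift (suc k) (multiples k (λ _ → p k)) m
    ≡⟨ cong (λ z → p k m + z) (shift-cong (suc k) m (λ i _ → sym (total-suc (λ _ → 1ℤ) k i))) ⟩
  p k m + shift (suc k) (p (suc k)) m                        ∎
  where open ≡-Reasoning

p-stable : ∀ {k m} → m ℕ.≤ k → p k m ≡ p m m
p-stable = stable p (λ k m m≤k → trans (p-suc k m)
  (trans (cong (λ z → p k m + z) (shift-> (p (suc k)) (s≤s m≤k))) (+-identityʳ _)))

unique : List ℕ → ℤ
unique μ = indicator (unique? μ)

d : ℕ → ℕ → ℤ
d = total unique

-- Multiplicity two or more of `k+1` has weight zero, and a single copy is distinct from all parts
-- up to `k`. As series, D_(k+1) = (1 + q^(k+1)) D_k.
d-suc : ∀ k m → d (suc k) m ≡ d k m + shift (suc k) (d k) m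
d-suc k m = begin
  d (suc k) m                                       ≡⟨ total-suc unique k m ⟩
  multiples k g m                                   ≡⟨ multiples-suc k g m ⟩
  d k m + shift (suc k) (multiples k (g ∘ suc)) m   ≡⟨ cong (λ z → d k m + z) (shift-cong (suc k) m (λ i _ → once i)) ⟩
  d k m + shift (suc k) (d k) m                     ∎
  where
  open ≡-Reasoning
  g : ℕ → ℕ → ℤ
  g c = total (unique ∘ (replicate c (suc k) ++_)) k
  fresh : ∀ {μ} → All (ℕ._≤ k) μ → All (suc k ≢_) μ
  fresh = All.map (λ x≤k eq → ℕ.<-irrefl (sym eq) (s≤s x≤k))
  at-most-once : ∀ c i → g (suc (suc c)) i ≡ 0ℤ
  at-most-once c i = total-zero k i (λ {μ} _ → indicator-no (unique? (replicate (suc (suc c)) (suc k) ++ μ))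
    (λ { ((x≢x ∷ _) ∷ _) → x≢x refl }))
  once : ∀ i → multiples k (g ∘ suc) i ≡ d k i
  once i = begin
    multiples k (g ∘ suc) i                                       ≡⟨ multiples-suc k (g ∘ suc) i ⟩
    g 1 i + shift (suc k) (multiples k (g ∘ suc ∘ suc)) i
      ≡⟨ cong₂ _+_ (total-cong k i (λ {μ} μ≤k → indicator-⇔ (unique? (suc k ∷ μ)) (unique? μ)
                      (λ { (_ ∷ u) → u }) (λ u → fresh μ≤k ∷ u)))
                   (trans (shift-cong (suc k) i (λ j _ → ∑-zero (suc j) (λ c →
                      trans (shift-cong (c ℕ.* suc k) j (λ l _ → at-most-once c l)) (shift-0 (c ℕ.* suc k) j))))
                    (shift-0 (suc k) i)) ⟩
    d k i + 0ℤ                                                    ≡⟨ +-identityʳ _ ⟩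
    d k i                                                         ∎
    where
    shift-0 : ∀ k m → shift k (λ _ → 0ℤ) m ≡ 0ℤ
    -- The zero series is an empty sum.
    shift-0 k m = shift-∑ k 0 (λ _ _ → 0ℤ) m

d-stable : ∀ {k m} → m ℕ.≤ k → d k m ≡ d m m
d-stable = stable d (λ k m m≤k → trans (d-suc k m)
  (trans (cong (λ z → d k m + z) (shift-> (d k) (s≤s m≤k))) (+-identityʳ _)))

+D₁ : ∀ {k m} → m ℕ.≤ k → + D₁ m ≡ d k m
+D₁ {k} {m} m≤k = trans (length-filter unique? (partitions m)) (sym (d-stable m≤k))

-- The mex as a count of initial segments.

-- 1 if mex μ > j and 0 otherwise.
covers : ℕ → List ℕ → ℤ
covers zero    μ = 1ℤ
covers (suc j) μ = covers j μ * indicator (suc j ∈? μ)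

covers-replicate : ∀ {j k} c {μ} → j ℕ.≤ k → covers j (replicate c (suc k) ++ μ) ≡ covers j μ
covers-replicate {zero}      c     _   = refl
covers-replicate {suc j} {k} c {μ} j<k = cong₂ _*_ (covers-replicate c (ℕ.<⇒≤ j<k))
  (indicator-⇔ (suc j ∈? (replicate c (suc k) ++ μ)) (suc j ∈? μ) to (∈-++⁺ʳ (replicate c (suc k))))
  where
  to : suc j ∈ replicate c (suc k) ++ μ → suc j ∈ μ
  to j∈ with ∈-++⁻ (replicate c (suc k)) j∈
  ... | inj₂ j∈μ = j∈μ
  ... | inj₁ j∈r = contradiction (sym (All.lookup (All.replicate⁺ {P = suc k ≡_} c refl) j∈r)) (ℕ.<⇒≢ (s≤s j<k))

-- Removing one copy of each of `1, …, j` lowers the size by `tri j`. In the induction on `k`, the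
-- part `k+1` has free multiplicity if `j ≤ k`; if `j = k+1`, it must occur, and splitting off one
-- copy turns `tri k` into `tri (suc k)`.
total-covers : ∀ {j k} m → j ℕ.≤ k → total (covers j) k m ≡ shift (tri j) (p k) m
total-covers {zero}  {zero}  m j≤k = refl
total-covers {j}     {suc k} m j≤k with ℕ.m≤n⇒m<n∨m≡n j≤k
... | inj₁ (s≤s j≤k′) = begin
  total (covers j) (suc k) m                                          ≡⟨ total-suc (covers j) k m ⟩
  multiples k (λ c → total (covers j ∘ (replicate c (suc k) ++_)) k) m
    ≡⟨ multiples-cong k m (λ c i → trans (total-cong k i (λ _ → covers-replicate c j≤k′)) (total-covers i j≤k′)) ⟩
  multiples k (λ _ → shift (tri j) (p k)) m                           ≡⟨ multiples-shift k (tri j) (λ _ → p k) m ⟩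
  shift (tri j) (multiples k (λ _ → p k)) m
    ≡⟨ shift-cong (tri j) m (λ i _ → total-suc (λ _ → 1ℤ) k i) ⟨
  shift (tri j) (p (suc k)) m                                         ∎
  where open ≡-Reasoning
... | inj₂ refl = begin
  total (covers (suc k)) (suc k) m                                    ≡⟨ total-suc (covers (suc k)) k m ⟩
  multiples k g m                                                     ≡⟨ multiples-suc k g m ⟩
  g 0 m + shift (suc k) (multiples k (g ∘ suc)) m
    ≡⟨ cong (λ z → z + shift (suc k) (multiples k (g ∘ suc)) m) (total-zero k m missing) ⟩
  0ℤ + shift (suc k) (multiples k (g ∘ suc)) m
    ≡⟨ +-identityˡ _ ⟩
  shift (suc k) (multiples k (g ∘ suc)) m
    ≡⟨ shift-cong (suc k) m (λ i _ → trans
         (multiples-cong k i (λ c l → trans (total-cong k l (λ _ → present c)) (total-covers {k} {k} l ℕ.≤-refl)))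
         (trans (multiples-shift k (tri k) (λ _ → p k) i)
           (shift-cong (tri k) i (λ l _ → sym (total-suc (λ _ → 1ℤ) k l))))) ⟩
  shift (suc k) (shift (tri k) (p (suc k))) m
    ≡⟨ shift-+ (suc k) (tri k) (p (suc k)) m ⟨
  shift (suc k ℕ.+ tri k) (p (suc k)) m
    ≡⟨ cong (λ z → shift z (p (suc k)) m) (tri-suc k) ⟨
  shift (tri (suc k)) (p (suc k)) m ∎
  where
  open ≡-Reasoning
  g : ℕ → ℕ → ℤ
  g c = total (covers (suc k) ∘ (replicate c (suc k) ++_)) k
  missing : ∀ {μ} → All (ℕ._≤ k) μ → covers (suc k) μ ≡ 0ℤ
  missing {μ} μ≤k = trans (cong (covers k μ *_) (indicator-no (suc k ∈? μ) (ℕ.1+n≰n ∘ All.lookup μ≤k)))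
                      (*-zeroʳ (covers k μ))
  present : ∀ c {μ} → covers (suc k) (replicate (suc c) (suc k) ++ μ) ≡ covers k μ
  present c {μ} = trans (cong₂ _*_ (covers-replicate {k} {k} (suc c) {μ} ℕ.≤-refl)
                                (indicator-yes (suc k ∈? (replicate (suc c) (suc k) ++ μ)) (here refl)))
                (*-identityʳ (covers k μ))

covers-0-+ : ∀ i {k μ} → covers k μ ≡ 0ℤ → covers (i ℕ.+ k) μ ≡ 0ℤ
covers-0-+ zero    c≡0 = c≡0
covers-0-+ (suc i) {k} {μ} c≡0 = cong (λ z → z * indicator (suc (i ℕ.+ k) ∈? μ)) (covers-0-+ i {k} {μ} c≡0)

mexSearch-∈ : ∀ f k μ → k ∈ μ → mexSearch (suc f) k μ ≡ mexSearch f (suc k) μ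
mexSearch-∈ f k μ k∈μ with k ∈? μ
... | yes _  = refl
... | no k∉μ = contradiction k∈μ k∉μ

mexSearch-∉ : ∀ f k μ → ¬ k ∈ μ → mexSearch (suc f) k μ ≡ k
mexSearch-∉ f k μ k∉μ with k ∈? μ
... | yes k∈μ = contradiction k∈μ k∉μ
... | no _    = refl

-- Each successful test uses one unit of fuel and contributes a summand 1; the first failure makes
-- all later summands 0. Search and sum are cut off alike when the fuel ends.
mexSearch-covers : ∀ f k μ → covers k μ ≡ 1ℤ →
  + mexSearch f (suc k) μ ≡ + suc k + ∑ f (λ i → covers (i ℕ.+ suc k) μ)
mexSearch-covers zero    k μ c≡1 = sym (+-identityʳ _)
mexSearch-covers (suc f) k μ c≡1 = go (suc k ∈? μ)
  where
  open ≡-Reasoning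
  lem : ∀ a b c → a + b + c ≡ b + (a + c)
  lem = solve-∀
  go : Dec (suc k ∈ μ) → + mexSearch (suc f) (suc k) μ ≡ + suc k + ∑ (suc f) (λ i → covers (i ℕ.+ suc k) μ)
  go (yes k∈μ) = begin
    + mexSearch (suc f) (suc k) μ
      ≡⟨ cong +_ (mexSearch-∈ f (suc k) μ k∈μ) ⟩
    + mexSearch f (suc (suc k)) μ
      ≡⟨ mexSearch-covers f (suc k) μ c′≡1 ⟩
    + suc (suc k) + ∑ f (λ i → covers (i ℕ.+ suc (suc k)) μ)
      ≡⟨ cong₂ _+_ (pos-+ 1 (suc k)) (∑-cong f (λ i → cong (λ z → covers z μ) (ℕ.+-suc i (suc k)))) ⟩
    1ℤ + + suc k + ∑ f (λ i → covers (suc i ℕ.+ suc k) μ)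
      ≡⟨ lem 1ℤ (+ suc k) (∑ f (λ i → covers (suc i ℕ.+ suc k) μ)) ⟩
    + suc k + (1ℤ + ∑ f (λ i → covers (suc i ℕ.+ suc k) μ))
      ≡⟨ cong (λ z → + suc k + (z + ∑ f (λ i → covers (suc i ℕ.+ suc k) μ))) (sym c′≡1) ⟩
    + suc k + ∑ (suc f) (λ i → covers (i ℕ.+ suc k) μ) ∎
    where
    c′≡1 : covers (suc k) μ ≡ 1ℤ
    c′≡1 = cong₂ _*_ c≡1 (indicator-yes (suc k ∈? μ) k∈μ)
  go (no k∉μ) = begin
    + mexSearch (suc f) (suc k) μ    ≡⟨ cong +_ (mexSearch-∉ f (suc k) μ k∉μ) ⟩
    + suc k                          ≡⟨ +-identityʳ (+ suc k) ⟨
    + suc k + 0ℤ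
      ≡⟨ cong (λ z → + suc k + z) (∑-zero (suc f) (λ i → covers-0-+ i {suc k} {μ} c′≡0)) ⟨
    + suc k + ∑ (suc f) (λ i → covers (i ℕ.+ suc k) μ) ∎
    where
    c′≡0 : covers (suc k) μ ≡ 0ℤ
    c′≡0 = trans (cong (covers k μ *_) (indicator-no (suc k ∈? μ) k∉μ)) (*-zeroʳ (covers k μ))

-- Presents the memberships as a family over `Fin j`, ready for the pigeonhole principle.
covers-0-or-all : ∀ j μ → covers j μ ≡ 0ℤ ⊎ (∀ (i : Fin j) → suc (toℕ i) ∈ μ)
covers-0-or-all zero    μ = inj₂ (λ ())
covers-0-or-all (suc j) μ with covers-0-or-all j μ | suc j ∈? μ
... | inj₁ c≡0 | m     = inj₁ (cong (λ z → z * indicator m) c≡0)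
... | inj₂ all | no _  = inj₁ (*-zeroʳ (covers j μ))
... | inj₂ all | yes j∈μ = inj₂ go
  where
  go : ∀ (i : Fin (suc j)) → suc (toℕ i) ∈ μ
  go i with ℕ.m≤n⇒m<n∨m≡n (Fin.toℕ≤pred[n] i)
  ... | inj₁ i<j = subst (λ z → suc z ∈ μ) (Fin.toℕ-fromℕ< i<j) (all (fromℕ< i<j))
  ... | inj₂ i≡j = subst (λ z → suc z ∈ μ) (sym i≡j) j∈μ

-- Pigeonhole: different numbers stand at different positions of `μ`, so `1, …, j` cannot all occur
-- in a shorter list.
covers-length : ∀ {j} μ → length μ ℕ.< j → covers j μ ≡ 0ℤ
covers-length {j} μ l<j with covers-0-or-all j μ
... | inj₁ c≡0 = c≡0
... | inj₂ all = contradiction (Fin.injective⇒≤ {f = λ i → index (all i)} inj) (ℕ.<⇒≱ l<j)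
  where
  inj : ∀ {x y} → index (all x) ≡ index (all y) → x ≡ y
  inj {x} {y} eq = Fin.toℕ-injective (ℕ.suc-injective
    (trans (lookup-index (all x)) (trans (cong (lookup μ) eq) (sym (lookup-index (all y))))))

covers-bound : ∀ {j m μ} → All (ℕ._≤ m) μ → m ℕ.< j → covers j μ ≡ 0ℤ
covers-bound {suc j} {m} {μ} μ≤m m<j = trans
  (cong (covers j μ *_) (indicator-no (suc j ∈? μ) (λ j∈μ → ℕ.<⇒≱ m<j (All.lookup μ≤m j∈μ))))
  (*-zeroʳ (covers j μ))

-- The range depends on `m` alone, so that the sum over `j` can be exchanged with the sum over the
-- partitions of `m`.
mex-covers : ∀ {m μ} → All (ℕ._≤ m) μ → + mex μ ≡ ∑ (suc m) (λ j → covers j μ)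
mex-covers {m} {μ} μ≤m = begin
  + mex μ
    ≡⟨ mexSearch-covers (suc l) 0 μ refl ⟩
  1ℤ + ∑ (suc l) (λ i → covers (i ℕ.+ 1) μ)
    ≡⟨ cong (λ z → 1ℤ + z) (∑-cong (suc l) (λ i → cong (λ z → covers z μ) (ℕ.+-comm i 1))) ⟩
  ∑ (suc (suc l)) (λ j → covers j μ)
    -- The summands vanish beyond `length μ` and also beyond `m`; the sum passes from one bound to
    -- the other through a range that contains both.
    ≡⟨ ∑-extend (ℕ.n≤1+n (suc l)) (λ j → covers-length μ) ⟩
  ∑ (suc l) (λ j → covers j μ)
    ≡⟨ ∑-extend (ℕ.m≤m+n (suc l) (suc m)) (λ j → covers-length μ) ⟨
  ∑ (suc l ℕ.+ suc m) (λ j → covers j μ)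
    ≡⟨ ∑-extend (ℕ.m≤n+m (suc m) (suc l)) (λ j → covers-bound μ≤m) ⟩
  ∑ (suc m) (λ j → covers j μ) ∎
  where
  open ≡-Reasoning
  l = length μ

j≤tri : ∀ j → j ℕ.≤ tri j
j≤tri zero    = z≤n
j≤tri (suc j) = ℕ.≤-trans (ℕ.m≤m+n (suc j) (tri j)) (ℕ.≤-reflexive (sym (tri-suc j)))

-- The series of `σmex` is ψ(q) P(q). The bounds on `j` and on the parts are raised from `m` to `k`,
-- so that one pair of truncations serves all `m ≤ k`.
+σmex : ∀ {k m} → m ℕ.≤ k → + σmex m ≡ ∑ (suc k) (λ j → shift (tri j) (p k) m)
+σmex {k} {m} m≤k = begin
  + σmex m
    ≡⟨ sumℤ-+sum mex (partitions m) ⟩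
  total (λ μ → + mex μ) m m
    ≡⟨ total-cong m m mex-covers ⟩
  total (λ μ → ∑ (suc m) (λ j → covers j μ)) m m
    ≡⟨ sumℤ-∑ (suc m) covers (partitions m) ⟩
  ∑ (suc m) (λ j → total (covers j) m m)
    ≡⟨ ∑-cong< (suc m) (λ { j (s≤s j≤m) → total-covers m j≤m }) ⟩
  ∑ (suc m) (λ j → shift (tri j) (p m) m)
    ≡⟨ ∑-cong (suc m) (λ j → shift-cong (tri j) m (λ i eq →
         let i≤m = ℕ.≤-trans (ℕ.m≤n+m i (tri j)) (ℕ.≤-reflexive eq)
         in trans (p-stable i≤m) (sym (p-stable (ℕ.≤-trans i≤m m≤k))))) ⟩
  ∑ (suc m) (λ j → shift (tri j) (p k) m)
    ≡⟨ ∑-extend (s≤s m≤k) (λ j m<j → shift-> (p k) (ℕ.<-≤-trans m<j (j≤tri j))) ⟨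
  ∑ (suc k) (λ j → shift (tri j) (p k) m) ∎
  where
  open ≡-Reasoning
  ∑-cong< : ∀ n {f g} → (∀ i → i ℕ.< n → f i ≡ g i) → ∑ n f ≡ ∑ n g
  ∑-cong< zero    f≗g = refl
  ∑-cong< (suc n) f≗g = cong₂ _+_ (f≗g 0 (s≤s z≤n)) (∑-cong< n (λ i i<n → f≗g (suc i) (s≤s i<n)))

-- Partitions into distinct parts, as a series in `q²`.

-- The coefficients of ∏_{i ≤ k} (1 + q^(2i)).
h : ℕ → ℕ → ℤ
h zero    m = p 0 m
h (suc k) m = h k m + shift (suc k ℕ.* 2) (h k) m

shift-even : ∀ k m {f g} → (∀ i → f (i ℕ.* 2) ≡ g i) → shift (k ℕ.* 2) f (m ℕ.* 2) ≡ shift k g m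
shift-even zero    m       f≗g = f≗g m
shift-even (suc k) zero    f≗g = refl
shift-even (suc k) (suc m) f≗g = shift-even k m f≗g

shift-odd : ∀ k m {f} → (∀ i → f (suc (i ℕ.* 2)) ≡ 0ℤ) → shift (k ℕ.* 2) f (suc (m ℕ.* 2)) ≡ 0ℤ
shift-odd zero    m       f≗0 = f≗0 m
shift-odd (suc k) zero    {f} f≗0 = shift-> {suc (k ℕ.* 2)} f (s≤s z≤n)
shift-odd (suc k) (suc m) f≗0 = shift-odd k m f≗0

-- The recursion of `h` is that of `d` with every offset doubled; hence `h k` is the series of `d k`
-- with `q²` for `q`, and its odd coefficients vanish.
h-even : ∀ k m → h k (m ℕ.* 2) ≡ d k m
h-even zero    zero    = refl
h-even zero    (suc m) = refl
h-even (suc k) m       = trans (cong₂ _+_ (h-even k m) (shift-even (suc k) m (h-even k))) (sym (d-suc k m))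

h-odd : ∀ k m → h k (suc (m ℕ.* 2)) ≡ 0ℤ
h-odd zero    m = refl
h-odd (suc k) m = cong₂ _+_ (h-odd k m) (shift-odd (suc k) m (h-odd k))

+D₁half : ∀ {k n} x → n ℕ.≤ k → + D₁half n x ≡ shift x (h k) n
+D₁half {k} {n} x n≤k with x ℕ.≤? n
... | no x≰n = sym (shift-> (h k) (ℕ.≰⇒> x≰n))
-- The remainder modulo 2 decides between `h-even` and `h-odd`; its bound excludes the third case.
... | yes x≤n with (n ℕ.∸ x) ℕ.% 2 in eq | m≡m%n+[m/n]*n (n ℕ.∸ x) 2 | m%n<n (n ℕ.∸ x) 2
...   | zero  | div | _ = begin
  + D₁ (i ℕ./ 2)           ≡⟨ +D₁ (ℕ.≤-trans (m/n≤m i 2) (ℕ.≤-trans (ℕ.m∸n≤m n x) n≤k)) ⟩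
  d k (i ℕ./ 2)            ≡⟨ h-even k (i ℕ./ 2) ⟨
  h k (i ℕ./ 2 ℕ.* 2)      ≡⟨ cong (h k) div ⟨
  h k i                    ≡⟨ shift-≤ (h k) x≤n ⟨
  shift x (h k) n          ∎
  where
  open ≡-Reasoning
  i = n ℕ.∸ x
...   | suc zero | div | _ = sym (trans (shift-≤ (h k) x≤n) (trans (cong (h k) div) (h-odd k ((n ℕ.∸ x) ℕ./ 2))))
...   | suc (suc _) | _ | s≤s (s≤s ())

+σmexShift : ∀ n x → + σmexShift n x ≡ shift x (λ m → + σmex m) n
+σmexShift n x with x ℕ.≤? n
... | yes x≤n = sym (shift-≤ (λ m → + σmex m) x≤n)
... | no x≰n  = sym (shift-> (λ m → + σmex m) (ℕ.≰⇒> x≰n))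

-- Signs, and the evaluated series as products.

-- Induction in steps of two, since `signPow (suc (suc e))` computes to `signPow e`.
signPow-^ : ∀ e q → signPow e * q ^ e ≡ (- q) ^ e
signPow-^ zero          q = refl
signPow-^ (suc zero)    q = lem q
  where
  lem : ∀ q → - 1ℤ * (q * 1ℤ) ≡ - q * 1ℤ
  lem = solve-∀
signPow-^ (suc (suc e)) q = trans (lem (signPow e) q (q ^ e)) (cong (λ z → - q * (- q * z)) (signPow-^ e q))
  where
  lem : ∀ s q r → s * (q * (q * r)) ≡ - q * (- q * (s * r))
  lem = solve-∀

module _ (q : ℤ) (N : ℕ) where

  open Mod (q ^ suc N)
  open Relation.Binary.Reasoning.Setoid ≈-setoid

  eval-p-0 : eval q (suc N) (p 0) ≡ 1ℤ
  eval-p-0 = trans (cong (λ z → 1ℤ + q * z) (eval-0 q N)) (lem q)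
    where
    lem : ∀ q → 1ℤ + q * 0ℤ ≡ 1ℤ
    lem = solve-∀

  eval-p-suc : ∀ k → eval q (suc N) (p (suc k)) * (1ℤ - q ^ suc k) ≈ eval q (suc N) (p k)
  eval-p-suc k = begin
    P′ * (1ℤ - x)            ≡⟨ lem₁ P′ x ⟩
    P′ + - (x * P′)          ≈⟨ +-cong (≈-reflexive (trans (eval-cong q (suc N) (p-suc k)) (eval-+ q (suc N) (p k) (shift (suc k) (p (suc k))))))
                                       (≈-refl { - (x * P′)}) ⟩
    P + S + - (x * P′)       ≈⟨ +-cong (+-cong (≈-refl {P}) (eval-shift q N (suc k) (p (suc k)))) (≈-refl { - (x * P′)}) ⟩
    P + x * P′ + - (x * P′)  ≡⟨ lem₂ P (x * P′) ⟩
    P                        ∎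
    where
    x = q ^ suc k
    P = eval q (suc N) (p k)
    P′ = eval q (suc N) (p (suc k))
    S = eval q (suc N) (shift (suc k) (p (suc k)))
    lem₁ : ∀ a x → a * (1ℤ - x) ≡ a + - (x * a)
    lem₁ = solve-∀
    lem₂ : ∀ a b → a + b + - b ≡ a
    lem₂ = solve-∀

  -- By `eval-p-suc`, P with parts up to `2i` is inverse to the product of all `1 - q^k` with
  -- `1 ≤ k ≤ 2i`, here split into odd and even `k`; each step treats `2i+2` and then `2i+1`.
  eval-p : ∀ i → eval q (suc N) (p (i ℕ.* 2)) * (poch q q i * poch q (q * q) i) ≈ 1ℤ
  eval-p zero    = ≈-reflexive (trans (*-identityʳ _) eval-p-0)
  eval-p (suc i) = begin
    P (suc i ℕ.* 2) * (poch q q (suc i) * poch q (q * q) (suc i))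
      ≡⟨ cong₂ (λ x y → P (suc i ℕ.* 2) * (x * y))
           (trans (poch-last q q i) (cong (λ z → U * (1ℤ - q * z)) (sq-^ q i)))
           (trans (poch-last q (q * q) i)
             (cong (λ z → Q * (1ℤ - z)) (trans (*-assoc q q _) (cong (λ z → q * (q * z)) (sq-^ q i))))) ⟩
    P (suc i ℕ.* 2) * (U * (1ℤ - x) * (Q * (1ℤ - q * x)))
      ≡⟨ lem (P (suc i ℕ.* 2)) U Q (1ℤ - x) (1ℤ - q * x) ⟩
    P (suc i ℕ.* 2) * (1ℤ - q * x) * ((1ℤ - x) * (U * Q))
      ≈⟨ *-congʳ ((1ℤ - x) * (U * Q)) (eval-p-suc (suc (i ℕ.* 2))) ⟩
    P (suc (i ℕ.* 2)) * ((1ℤ - x) * (U * Q))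
      ≡⟨ *-assoc (P (suc (i ℕ.* 2))) (1ℤ - x) (U * Q) ⟨
    P (suc (i ℕ.* 2)) * (1ℤ - x) * (U * Q)
      ≈⟨ *-congʳ (U * Q) (eval-p-suc (i ℕ.* 2)) ⟩
    P (i ℕ.* 2) * (U * Q)
      ≈⟨ eval-p i ⟩
    1ℤ ∎
    where
    P : ℕ → ℤ
    P k = eval q (suc N) (p k)
    U = poch q q i
    Q = poch q (q * q) i
    x = q ^ suc (i ℕ.* 2)
    lem : ∀ P U Q a b → P * (U * a * (Q * b)) ≡ P * b * (a * (U * Q))
    lem = solve-∀

  eval-h : ∀ k → eval q (suc N) (h k) ≈ poch q (- (q * q)) k
  eval-h zero    = ≈-reflexive eval-p-0
  eval-h (suc k) = begin
    eval q (suc N) (h (suc k))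
      ≡⟨ eval-+ q (suc N) (h k) (shift (suc k ℕ.* 2) (h k)) ⟩
    E + eval q (suc N) (shift (suc k ℕ.* 2) (h k))
      ≈⟨ +-cong (≈-refl {E}) (eval-shift q N (suc k ℕ.* 2) (h k)) ⟩
    E + q ^ (suc k ℕ.* 2) * E
      ≡⟨ cong (λ z → E + z * E) (sq-^ q (suc k)) ⟨
    E + q * q * (q * q) ^ k * E
      ≡⟨ lem E (q * q) ((q * q) ^ k) ⟩
    E * (1ℤ - - (q * q) * (q * q) ^ k)
      ≈⟨ *-congʳ (1ℤ - - (q * q) * (q * q) ^ k) (eval-h k) ⟩
    poch q (- (q * q)) k * (1ℤ - - (q * q) * (q * q) ^ k)
      ≡⟨ poch-last q (- (q * q)) k ⟨
    poch q (- (q * q)) (suc k) ∎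
    where
    E = eval q (suc N) (h k)
    lem : ∀ E x r → E + x * r * E ≡ E * (1ℤ - - x * r)
    lem = solve-∀

-- Comparison of the two sides.

module _ (n : ℕ) where

  private
    -- The precision of `triangular-≈` for `n` factors; the index `n` read off at the end lies below
    -- it.
    L = suc (n ℕ.* 2)

    n≤2n : n ℕ.≤ n ℕ.* 2
    n≤2n = ℕ.m≤m*n n 2

  -- Equal to `σmex` up to index `2n`. The factor `1ℤ` gives the sum the shape of `eval-∑`.
  σ : ℕ → ℤ
  σ m = ∑ L (λ j → 1ℤ * shift (tri j) (p (n ℕ.* 2)) m)

  left right : ℕ → ℤ
  left  m = ∑ L (λ j → signPow (tri j) * shift (tri j) σ m)
  right m = ∑ L (λ j → 1ℤ * shift (tri j) (h n) m)

  -- The left series is ψ(-q) ψ(q) P(q) and the right one ψ(q) ∏ (1 + q^(2i)); beside the common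
  -- ψ(q), `triangular-≈` does the rest.
  eval-left≈right : ∀ q → let open Mod (q ^ L) in eval q L left ≈ eval q L right
  eval-left≈right q = begin
    eval q L left              ≈⟨ eval-∑ q (n ℕ.* 2) L (signPow ∘ tri) tri σ ⟩
    ∑ L (λ j → signPow (tri j) * q ^ tri j) * eval q L σ
      ≡⟨ cong (λ z → z * eval q L σ) (∑-cong L (λ j → signPow-^ (tri j) q)) ⟩
    ψ⁻ * eval q L σ            ≈⟨ *-congˡ ψ⁻ (eval-∑ q (n ℕ.* 2) L (λ _ → 1ℤ) tri (p (n ℕ.* 2))) ⟩
    ψ⁻ * (ψ⁺ * P)              ≡⟨ lem ψ⁻ ψ⁺ P ⟩
    ψ⁺ * (ψ⁻ * P)              ≈⟨ *-congˡ ψ⁺ (triangular-≈ q n P (eval-p q (n ℕ.* 2) n)) ⟩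
    ψ⁺ * poch q (- (q * q)) n  ≈⟨ *-congˡ ψ⁺ (eval-h q (n ℕ.* 2) n) ⟨
    ψ⁺ * eval q L (h n)        ≈⟨ eval-∑ q (n ℕ.* 2) L (λ _ → 1ℤ) tri (h n) ⟨
    eval q L right             ∎
    where
    open Mod (q ^ L)
    open Relation.Binary.Reasoning.Setoid ≈-setoid
    ψ⁻ = ∑ L (λ j → (- q) ^ tri j)
    ψ⁺ = ∑ L (λ j → 1ℤ * q ^ tri j)
    P = eval q L (p (n ℕ.* 2))
    lem : ∀ a b c → a * (b * c) ≡ b * (a * c)
    lem = solve-∀

  tri-> : ∀ f j → n ℕ.< j → shift (tri j) f n ≡ 0ℤ
  tri-> f j n<j = shift-> f (ℕ.<-≤-trans n<j (j≤tri j))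

  lhs-left : lhs n ≡ left n
  lhs-left = begin
    lhs n
      ≡⟨ sumℤ-upTo (λ j → signPow (tri j) * + σmexShift n (tri j)) (suc n) ⟩
    ∑ (suc n) (λ j → signPow (tri j) * + σmexShift n (tri j))
      -- Only coefficients of index at most `n` enter, so `+σmex` applies with the bound `2n`.
      ≡⟨ ∑-cong (suc n) (λ j → cong (signPow (tri j) *_)
           (trans (+σmexShift n (tri j)) (shift-cong (tri j) n (λ i eq →
             trans (+σmex (ℕ.≤-trans (ℕ.≤-trans (ℕ.m≤n+m i (tri j)) (ℕ.≤-reflexive eq)) n≤2n))
                   (∑-cong L (λ l → sym (*-identityˡ (shift (tri l) (p (n ℕ.* 2)) i)))))))) ⟩
    ∑ (suc n) (λ j → signPow (tri j) * shift (tri j) σ n)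
      ≡⟨ ∑-extend (s≤s n≤2n) (λ j n<j → trans (cong (signPow (tri j) *_) (tri-> σ j n<j)) (*-zeroʳ (signPow (tri j)))) ⟨
    left n ∎
    where open ≡-Reasoning

  rhs-right : + rhs n ≡ right n
  rhs-right = begin
    + rhs n
      ≡⟨ sumℤ-+sum (λ j → D₁half n (tri j)) (upTo (suc n)) ⟩
    _ ≡⟨ sumℤ-upTo (λ j → + D₁half n (tri j)) (suc n) ⟩
    ∑ (suc n) (λ j → + D₁half n (tri j))
      ≡⟨ ∑-cong (suc n) (λ j → trans (+D₁half {n} {n} (tri j) ℕ.≤-refl) (sym (*-identityˡ (shift (tri j) (h n) n)))) ⟩
    ∑ (suc n) (λ j → 1ℤ * shift (tri j) (h n) n)
      ≡⟨ ∑-extend (s≤s n≤2n) (λ j n<j → trans (*-identityˡ (shift (tri j) (h n) n)) (tri-> (h n) j n<j)) ⟨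
    right n ∎
    where open ≡-Reasoning

theorem5 : (n : ℕ) → lhs n ≡ + rhs n
theorem5 n = begin
  lhs n      ≡⟨ lhs-left n ⟩
  left n n   ≡⟨ coefficients-unique (suc (n ℕ.* 2)) (left n) (right n) (λ k → eval-left≈right n (+ suc k))
                  n (s≤s (ℕ.m≤m*n n 2)) ⟩
  right n n  ≡⟨ rhs-right n ⟨
  + rhs n    ∎
  where open ≡-Reasoning
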